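{- For all $m\ge 2$ and $n\ge 4$, the generalized wheel graph $W_{m,n}=\overline{K}_m+C_n$, with vertex set $V$, satisfies $\operatorname{nim}(\mathrm{DNT}(W_{m,n}))=\operatorname{pty}(V)$.
   Context: The generalized wheel graph $W_{m,n}$ is the join $\overline{K}_m+C_n$ of the edgeless graph on $m$ vertices and the cycle graph on $n$ vertices, i.e. their disjoint union together with all edges between the two vertex sets; it has $m+n$ vertices. For a graph $G$ with vertex set $V$, a set $K\subseteq V$ is convex if it contains every vertex lying on any shortest path between two elements of $K$. The convex hull $[P]$ of $P\subseteq V$ is the smallest convex set containing $P$. For a finite set $A$, $\operatorname{pty}(A):=|A|\bmod 2\in\{0,1\}$. The game $\mathrm{DNT}(G)$: positions are the sets $P\subseteq V$ with $[V\setminus P]=V$; the starting position is $\emptyset$; the options of $P$ are the sets $P\cup\{v\}$ with $v\in V\setminus P$ and $[V\setminus(P\cup\{v\})]=V$. The nim-value of a position is defined recursively by $\operatorname{nim}(p)=\operatorname{mex}\{\operatorname{nim}(q): q\text{ an option of }p\}$, where $\operatorname{mex}(A)$ is the smallest nonnegative integer not in $A$; the nim-value of a game is that of its starting position. -}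

module Defs where

import Data.Bool.Properties as Bool
open import Data.Bool.Base using (if_then_else_)
open import Data.Empty using () renaming (⊥ to Empty)
open import Data.Fin.Base using (Fin; zero; suc; toℕ; splitAt)
open import Data.Fin.Properties using (_≟_; all?; injective⇒≤; toℕ-injective; toℕ<n)
open import Data.Fin.Subset
  using (Subset; inside; outside; _∈_; _∉_; _⊆_; _∪_; _⊃_; ⁅_⁆; ∁; ∣_∣; ⊤; ⊥)
open import Data.Fin.Subset.Induction using (⊃-wellFounded)
open import Data.Fin.Subset.Properties
  using (_∈?_; _⊆?_; ⊆-antisym; ⊆-max; p⊆p∪q; q⊆p∪q; x∈⁅x⁆; ∉⊥; x∉p⇒x∈∁p)
open import Data.List.Base
  using (List; []; _∷_; length; head; last; lookup; allFin; mapMaybe; map)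
open import Data.List.Membership.Propositional using (mapWith∈)
  renaming (_∈_ to _∈ᴸ_; _∉_ to _∉ᴸ_)
open import Data.List.Membership.Propositional.Properties
  using (mapWith∈-cong; mapWith∈≗map; ∈-allFin; ∈-lookup)
import Data.List.Relation.Unary.All as All
open import Data.List.Relation.Unary.AllPairs using (_∷_)
open import Data.List.Relation.Unary.Any using (here; there; index)
open import Data.List.Relation.Unary.Any.Properties using (lookup-index)
open import Data.List.Relation.Unary.Linked using (Linked; linked?)
open import Data.List.Relation.Unary.Unique.Propositional using (Unique)
import Data.List.Relation.Unary.Unique.DecPropositional as DecUnique
open import Data.Maybe.Base as Maybe using (Maybe; just; nothing)
import Data.Maybe.Properties as Maybe
open import Data.Nat.Base using (ℕ; zero; suc; _+_; _≤_; _<_; _%_; z≤n; s≤s; s≤s⁻¹)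
import Data.Nat.Properties as ℕ
open import Data.List.Membership.DecPropositional ℕ._≟_ using () renaming (_∈?_ to _∈ᴺ?_)
open import Data.Product.Base using (Σ; ∃; _×_; _,_; proj₁; proj₂)
open import Data.Sum.Base using (_⊎_; inj₁; inj₂; swap)
open import Data.Unit.Base using (tt) renaming (⊤ to Unit)
open import Data.Vec.Base using ([]; _∷_; tabulate)
open import Data.Vec.Properties using (≡-dec; lookup∘tabulate; lookup⇒[]=; []=⇒lookup)
open import Function.Base using (_∘_)
open import Induction.WellFounded using (WellFounded; Acc; acc; module Subrelation)
import Relation.Binary.Construct.On as On
open import Relation.Binary.Definitions using () renaming (Decidable to Decidable₂)
open import Relation.Binary.PropositionalEquality
  using (_≡_; _≢_; refl; sym; trans; cong; subst)
open import Relation.Nullary using (Dec; yes; no; ¬_; does; contradiction)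
open import Relation.Nullary.Decidable
  using (map′; ¬?; _×-dec_; _⊎-dec_; _→-dec_; dec⇒maybe; dec-true)
open import Relation.Unary using (Decidable)
open import Axiom.UniquenessOfIdentityProofs using (module Decidable⇒UIP)

private
  variable
    n v : ℕ

------------------------------------------------------------------------
-- Finite simple graphs

record Graph (v : ℕ) : Set₁ where
  field
    Adj       : Fin v → Fin v → Set
    adj?      : Decidable₂ Adj
    adj-sym   : ∀ {x y} → Adj x y → Adj y x
    adj-irr   : ∀ {x} → ¬ Adj x x

open Graph

Edgeless : (m : ℕ) → Graph m
Edgeless m .Adj x y  = Empty
Edgeless m .adj? x y = no λ ()
Edgeless m .adj-sym ()
Edgeless m .adj-irr ()

data Next {n : ℕ} (x y : Fin n) : Set where
  step : suc (toℕ x) ≡ toℕ y → Next x y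
  wrap : suc (toℕ x) ≡ n → toℕ y ≡ 0 → Next x y

next? : Decidable₂ (Next {n})
next? {n} x y =
  map′ (λ { (inj₁ p) → step p ; (inj₂ (p , q)) → wrap p q })
       (λ { (step p) → inj₁ p ; (wrap p q) → inj₂ (p , q) })
       ((suc (toℕ x) ℕ.≟ toℕ y) ⊎-dec (suc (toℕ x) ℕ.≟ n) ×-dec (toℕ y ℕ.≟ 0))

-- The condition x ≢ y is redundant unless n = 1, where it removes a loop.
Cycle : (n : ℕ) → Graph n
Cycle n .Adj x y  = x ≢ y × (Next x y ⊎ Next y x)
Cycle n .adj? x y = ¬? (x ≟ y) ×-dec (next? x y ⊎-dec next? y x)
Cycle n .adj-sym (x≢y , e) = x≢y ∘ sym , swap e
Cycle n .adj-irr (x≢x , _) = x≢x refl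

module _ {m n : ℕ} (G : Graph m) (H : Graph n) where

  JoinAdj : Fin m ⊎ Fin n → Fin m ⊎ Fin n → Set
  JoinAdj (inj₁ x) (inj₁ y) = Adj G x y
  JoinAdj (inj₁ x) (inj₂ y) = Unit
  JoinAdj (inj₂ x) (inj₁ y) = Unit
  JoinAdj (inj₂ x) (inj₂ y) = Adj H x y

  joinAdj? : Decidable₂ JoinAdj
  joinAdj? (inj₁ x) (inj₁ y) = adj? G x y
  joinAdj? (inj₁ x) (inj₂ y) = yes tt
  joinAdj? (inj₂ x) (inj₁ y) = yes tt
  joinAdj? (inj₂ x) (inj₂ y) = adj? H x y

  joinAdj-sym : ∀ x y → JoinAdj x y → JoinAdj y x
  joinAdj-sym (inj₁ x) (inj₁ y) = adj-sym G
  joinAdj-sym (inj₁ x) (inj₂ y) = λ _ → tt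
  joinAdj-sym (inj₂ x) (inj₁ y) = λ _ → tt
  joinAdj-sym (inj₂ x) (inj₂ y) = adj-sym H

  joinAdj-irr : ∀ x → ¬ JoinAdj x x
  joinAdj-irr (inj₁ x) = adj-irr G
  joinAdj-irr (inj₂ x) = adj-irr H

  -- `splitAt m` identifies Fin (m + n) with Fin m ⊎ Fin n.
  Join : Graph (m + n)
  Join .Adj x y  = JoinAdj (splitAt m x) (splitAt m y)
  Join .adj? x y = joinAdj? (splitAt m x) (splitAt m y)
  Join .adj-sym {x} {y} = joinAdj-sym (splitAt m x) (splitAt m y)
  Join .adj-irr {x}     = joinAdj-irr (splitAt m x)

Wheel : (m n : ℕ) → Graph (m + n)
Wheel m n = Join (Edgeless m) (Cycle n)

------------------------------------------------------------------------
-- Deciding quantified statements over finite domains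

allSubset? : {Q : Subset n → Set} → Decidable Q → Dec (∀ p → Q p)
allSubset? {zero}  Q? = map′ (λ { q [] → q }) (λ q → q []) (Q? [])
allSubset? {suc n} Q? =
  map′ (λ { (i , o) (inside ∷ p) → i p ; (i , o) (outside ∷ p) → o p })
       (λ q → (λ p → q (inside ∷ p)) , (λ p → q (outside ∷ p)))
       (allSubset? (λ p → Q? (inside ∷ p)) ×-dec allSubset? (λ p → Q? (outside ∷ p)))

allList≤? : ∀ k {Q : List (Fin v) → Set} → Decidable Q →
            Dec (∀ xs → length xs ≤ k → Q xs)
allList≤? zero Q? = map′ (λ { q [] _ → q }) (λ q → q [] z≤n) (Q? [])
allList≤? (suc k) Q? =
  map′ (λ { (q , qs) [] _ → q ; (q , qs) (x ∷ xs) l → qs x xs (s≤s⁻¹ l) })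
       (λ q → q [] z≤n , λ x xs l → q (x ∷ xs) (s≤s l))
       (Q? [] ×-dec all? (λ x → allList≤? k (λ xs → Q? (x ∷ xs))))

unique-lookup-injective : {A : Set} {xs : List A} → Unique xs →
                          ∀ {i j} → lookup xs i ≡ lookup xs j → i ≡ j
unique-lookup-injective (_  ∷ _) {zero}  {zero}  _  = refl
unique-lookup-injective (x∉ ∷ _) {zero}  {suc j} eq =
  contradiction eq (All.lookup x∉ (∈-lookup j))
unique-lookup-injective (x∉ ∷ _) {suc i} {zero}  eq =
  contradiction (sym eq) (All.lookup x∉ (∈-lookup i))
unique-lookup-injective (_  ∷ u) {suc i} {suc j} eq =
  cong suc (unique-lookup-injective u eq)

unique⇒length≤ : {xs : List (Fin v)} → Unique xs → length xs ≤ v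
unique⇒length≤ u = injective⇒≤ (unique-lookup-injective u)

------------------------------------------------------------------------
-- Convexity

module _ {v : ℕ} (G : Graph v) where

  IsPath : Fin v → Fin v → List (Fin v) → Set
  IsPath u w xs = head xs ≡ just u × last xs ≡ just w × Linked (Adj G) xs × Unique xs

  -- The list of vertices of a path is one longer than the path itself, so
  -- comparing lists by length is comparing paths by length.
  IsShortestPath : Fin v → Fin v → List (Fin v) → Set
  IsShortestPath u w xs =
    IsPath u w xs × (∀ ys → IsPath u w ys → length xs ≤ length ys)

  Convex : Subset v → Set
  Convex K = ∀ u w → u ∈ K → w ∈ K →
             ∀ xs → IsShortestPath u w xs → ∀ x → x ∈ᴸ xs → x ∈ K

  isPath? : ∀ u w → Decidable (IsPath u w)
  isPath? u w xs = Maybe.≡-dec _≟_ (head xs) (just u)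
             ×-dec Maybe.≡-dec _≟_ (last xs) (just w)
             ×-dec linked? (adj? G) xs
             ×-dec DecUnique.unique? _≟_ xs

  path-length≤ : ∀ {u w xs} → IsPath u w xs → length xs ≤ v
  path-length≤ (_ , _ , _ , unique) = unique⇒length≤ unique

  isShortestPath? : ∀ u w → Decidable (IsShortestPath u w)
  isShortestPath? u w xs = isPath? u w xs ×-dec
    map′ (λ min ys p → min ys (path-length≤ p) p)
         (λ min ys _ → min ys)
         (allList≤? v (λ ys → isPath? u w ys →-dec (length xs ℕ.≤? length ys)))

  convex? : Decidable Convex
  convex? K =
    all? λ u → all? λ w → (u ∈? K) →-dec ((w ∈? K) →-dec
      map′ (λ conv xs s x → All.lookup (conv xs (path-length≤ (proj₁ s)) s))
           (λ conv xs _ s → All.tabulate (conv xs s _))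
           (allList≤? v (λ xs → isShortestPath? u w xs →-dec All.all? (_∈? K) xs)))

  InHull : Subset v → Fin v → Set
  InHull P x = ∀ K → Convex K × P ⊆ K → x ∈ K

  -- Opaque so that abstracting over it does not unfold an exhaustive search.
  opaque
    inHull? : ∀ P → Decidable (InHull P)
    inHull? P x = allSubset? λ K → (convex? K ×-dec (P ⊆? K)) →-dec (x ∈? K)

  -- The intersection of all convex sets containing P; `hull-convex`,
  -- `⊆-hull` and `hull-least` say that it is the smallest such set.
  hull : Subset v → Subset v
  hull P = tabulate λ x → does (inHull? P x)

  ∈-hull⁺ : ∀ {P x} → InHull P x → x ∈ hull P
  ∈-hull⁺ {P} {x} h = lookup⇒[]= x (hull P)
    (trans (lookup∘tabulate _ x) (dec-true (inHull? P x) h))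

  ∈-hull⁻ : ∀ {P x} → x ∈ hull P → InHull P x
  ∈-hull⁻ {P} {x} x∈ with inHull? P x | trans (sym (lookup∘tabulate _ x)) ([]=⇒lookup x∈)
  ... | yes h | _ = h
  ... | no  _ | ()

  ⊆-hull : ∀ P → P ⊆ hull P
  ⊆-hull P x∈P = ∈-hull⁺ λ K (_ , P⊆K) → P⊆K x∈P

  hull-convex : ∀ P → Convex (hull P)
  hull-convex P u w u∈ w∈ xs s x x∈xs = ∈-hull⁺ λ K K⊇ →
    proj₁ K⊇ u w (∈-hull⁻ u∈ K K⊇) (∈-hull⁻ w∈ K K⊇) xs s x x∈xs

  hull-least : ∀ {P K} → Convex K → P ⊆ K → hull P ⊆ K
  hull-least {K = K} convex P⊆K x∈ = ∈-hull⁻ x∈ K (convex , P⊆K)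

------------------------------------------------------------------------
-- Impartial games and nim-values

record Game : Set₁ where
  field
    Position : Set
    start    : Position
    options  : Position → List Position
    finite   : WellFounded (λ q p → q ∈ᴸ options p)

mexFrom : ℕ → ℕ → List ℕ → ℕ
mexFrom zero    k A = k
mexFrom (suc f) k A = if does (k ∈ᴺ? A) then mexFrom f (suc k) A else k

-- The search stops by `length A` at the latest; see `mex-∉` and `mex-least`.
mex : List ℕ → ℕ
mex A = mexFrom (length A) 0 A

mexFrom-least : ∀ f {k} A → (∀ j → j < k → j ∈ᴸ A) → ∀ j → j < mexFrom f k A → j ∈ᴸ A
mexFrom-least zero        A below = below
mexFrom-least (suc f) {k} A below with k ∈ᴺ? A
... | no  _   = below
... | yes k∈A = mexFrom-least f A below′
  where
  below′ : ∀ j → j < suc k → j ∈ᴸ A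
  below′ j j<1+k with ℕ.m<1+n⇒m<n∨m≡n j<1+k
  ... | inj₁ j<k  = below j j<k
  ... | inj₂ refl = k∈A

mex-least : ∀ A j → j < mex A → j ∈ᴸ A
mex-least A = mexFrom-least (length A) A λ _ ()

mexFrom-stops : ∀ f k A → mexFrom f k A ∉ᴸ A ⊎ mexFrom f k A ≡ k + f
mexFrom-stops zero    k A = inj₂ (sym (ℕ.+-identityʳ k))
mexFrom-stops (suc f) k A with k ∈ᴺ? A
... | no  k∉A = inj₁ k∉A
... | yes _   rewrite ℕ.+-suc k f = mexFrom-stops f (suc k) A

mex-∉ : ∀ A → mex A ∉ᴸ A
mex-∉ A mex∈A with mexFrom-stops (length A) 0 A
... | inj₁ mex∉A = mex∉A mex∈A
... | inj₂ mex≡ℓ = ℕ.1+n≰n (injective⇒≤ {f = f} f-injective)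
  where
  all∈A : (i : Fin (suc (length A))) → toℕ i ∈ᴸ A
  all∈A i with ℕ.m<1+n⇒m<n∨m≡n (toℕ<n i)
  ... | inj₁ i<ℓ = mex-least A (toℕ i) (subst (toℕ i <_) (sym mex≡ℓ) i<ℓ)
  ... | inj₂ i≡ℓ = subst (_∈ᴸ A) (trans mex≡ℓ (sym i≡ℓ)) mex∈A

  f : Fin (suc (length A)) → Fin (length A)
  f i = index (all∈A i)

  f-injective : ∀ {i j} → f i ≡ f j → i ≡ j
  f-injective {i} {j} eq = toℕ-injective
    (trans (lookup-index (all∈A i))
      (trans (cong (lookup A) eq) (sym (lookup-index (all∈A j)))))

module _ (𝒢 : Game) where
  open Game 𝒢

  nimAcc : ∀ p → Acc (λ q p → q ∈ᴸ options p) p → ℕ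
  nimAcc p (acc rs) = mex (mapWith∈ (options p) λ q∈ → nimAcc _ (rs q∈))

  nimPos : Position → ℕ
  nimPos p = nimAcc p (finite p)

  nim : ℕ
  nim = nimPos start

  nimAcc-irrelevant : ∀ p (a b : Acc _ p) → nimAcc p a ≡ nimAcc p b
  nimAcc-irrelevant p (acc rs) (acc rs′) =
    cong mex (mapWith∈-cong (options p) _ _ λ q∈ → nimAcc-irrelevant _ (rs q∈) (rs′ q∈))

  nimPos-unfold : ∀ p → nimPos p ≡ mex (map nimPos (options p))
  nimPos-unfold p = trans (go (finite p)) (cong mex (mapWith∈≗map nimPos (options p)))
    where
    go : (a : Acc _ p) → nimAcc p a ≡ mex (mapWith∈ (options p) λ {q} _ → nimPos q)
    go (acc rs) = cong mex (mapWith∈-cong (options p) _ _ λ q∈ →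
      nimAcc-irrelevant _ (rs q∈) (finite _))

------------------------------------------------------------------------
-- The game DNT

∈-mapMaybe⁻ : {A B : Set} (f : A → Maybe B) (xs : List A) {y : B} →
              y ∈ᴸ mapMaybe f xs → ∃ λ x → f x ≡ just y
∈-mapMaybe⁻ f (x ∷ xs) y∈ with f x in eq
∈-mapMaybe⁻ f (x ∷ xs) (here refl) | just _  = x , eq
∈-mapMaybe⁻ f (x ∷ xs) (there y∈)  | just _  = ∈-mapMaybe⁻ f xs y∈
∈-mapMaybe⁻ f (x ∷ xs) y∈          | nothing = ∈-mapMaybe⁻ f xs y∈

∈-mapMaybe⁺ : {A B : Set} (f : A → Maybe B) {xs : List A} {x : A} {y : B} →
              x ∈ᴸ xs → f x ≡ just y → y ∈ᴸ mapMaybe f xs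
∈-mapMaybe⁺ f (here refl) eq rewrite eq = here refl
∈-mapMaybe⁺ f {z ∷ _} (there x∈) eq with f z
... | just _  = there (∈-mapMaybe⁺ f x∈ eq)
... | nothing = ∈-mapMaybe⁺ f x∈ eq

map-dec⇒maybe⁻ : {A B : Set} {g : A → B} {y : B} (d : Dec A) →
                 Maybe.map g (dec⇒maybe d) ≡ just y → ∃ λ a → g a ≡ y
map-dec⇒maybe⁻ (yes a) refl = a , refl

map-dec⇒maybe⁺ : {A B : Set} {g : A → B} {y : B} (d : Dec A) →
                 A → (∀ a → g a ≡ y) → Maybe.map g (dec⇒maybe d) ≡ just y
map-dec⇒maybe⁺ (yes a) _ eq = cong just (eq a)
map-dec⇒maybe⁺ (no ¬a) a _  = contradiction a ¬a

module _ {v : ℕ} (G : Graph v) where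

  IsPosition : Subset v → Set
  IsPosition P = hull G (∁ P) ≡ ⊤

  isPosition? : Decidable IsPosition
  isPosition? P = ≡-dec Bool._≟_ (hull G (∁ P)) ⊤

  DNTPosition : Set
  DNTPosition = Σ (Subset v) IsPosition

  ∅-isPosition : IsPosition ⊥
  ∅-isPosition = ⊆-antisym (⊆-max _) λ _ → ⊆-hull G (∁ ⊥) (x∉p⇒x∈∁p ∉⊥)

  Playable : Subset v → Fin v → Set
  Playable P x = x ∉ P × IsPosition (P ∪ ⁅ x ⁆)

  playable? : ∀ P → Decidable (Playable P)
  playable? P x = ¬? (x ∈? P) ×-dec isPosition? (P ∪ ⁅ x ⁆)

  play : DNTPosition → Fin v → Maybe DNTPosition
  play (P , _) x = Maybe.map (λ (_ , pos) → P ∪ ⁅ x ⁆ , pos) (dec⇒maybe (playable? P x))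

  dntOptions : DNTPosition → List DNTPosition
  dntOptions p = mapMaybe (play p) (allFin v)

  IsOption : DNTPosition → DNTPosition → Set
  IsOption (Q , _) (P , _) = ∃ λ x → x ∉ P × Q ≡ P ∪ ⁅ x ⁆

  ∈-dntOptions⁻ : ∀ q p → q ∈ᴸ dntOptions p → IsOption q p
  ∈-dntOptions⁻ q p q∈ with ∈-mapMaybe⁻ (play p) (allFin v) q∈
  ... | x , eq with map-dec⇒maybe⁻ (playable? (proj₁ p) x) eq
  ... | (x∉P , _) , refl = x , x∉P , refl

  ∈-dntOptions⁺ : ∀ q p → IsOption q p → q ∈ᴸ dntOptions p
  ∈-dntOptions⁺ (_ , pos) p (x , x∉P , refl) =
    ∈-mapMaybe⁺ (play p) (∈-allFin x)
      (map-dec⇒maybe⁺ (playable? (proj₁ p) x) (x∉P , pos)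
        λ (_ , pos′) → cong (_ ,_) (Decidable⇒UIP.≡-irrelevant (≡-dec Bool._≟_) pos′ pos))

  option⇒⊃ : ∀ q p → q ∈ᴸ dntOptions p → proj₁ q ⊃ proj₁ p
  option⇒⊃ q p@(P , _) q∈ with ∈-dntOptions⁻ q p q∈
  ... | x , x∉P , refl = p⊆p∪q ⁅ x ⁆ , x , q⊆p∪q P ⁅ x ⁆ (x∈⁅x⁆ x) , x∉P

  DNT : Game
  DNT = record
    { Position = DNTPosition
    ; start    = ⊥ , ∅-isPosition
    ; options  = dntOptions
    ; finite   = Subrelation.wellFounded (λ {q} {p} → option⇒⊃ q p)
                   (On.wellFounded proj₁ ⊃-wellFounded)
    }

pty : Subset n → ℕ
pty A = ∣ A ∣ % 2

{-# OPTIONS --safe #-}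

-- In a join of two non-complete graphs any two distinct non-adjacent vertices
-- have hull V: their common neighbours contain one whole side, which in turn
-- contains a non-adjacent pair having the other side as common neighbours.
-- Cliques are convex, so P is a position iff V ∖ P is not a clique.  A play can
-- therefore continue exactly until V ∖ P is a non-adjacent pair, so every play
-- has |V| − 2 moves and nim-values are determined by parity.
module Submission where

open import Defs
open import Data.Fin.Base using (Fin; zero; suc; splitAt; _↑ˡ_; _↑ʳ_)
open import Data.Fin.Properties
  using (_≟_; any?; splitAt-↑ˡ; splitAt-↑ʳ; splitAt⁻¹-↑ˡ; splitAt⁻¹-↑ʳ; ↑ˡ-injective; ↑ʳ-injective)
open import Data.Fin.Subset
  using (Subset; inside; outside; _∈_; _∉_; _∪_; ⁅_⁆; ∁; ∣_∣; ⊤; ⊥; Nonempty)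
open import Data.Fin.Subset.Properties
  using (_∈?_; ⊆-antisym; ⊆-max; ∈⊤; ∉⊥; ∪-identityʳ; x∈p∪q⁻; x∈p∪q⁺; x∈⁅x⁆; x∈⁅y⁆⇒x≡y;
         x∉p⇒x∈∁p; x∈∁p⇒x∉p; nonempty?; Empty-unique; ∣⊥∣≡0)
open import Data.List.Base using (List; []; _∷_; length; head; last; map)
open import Data.List.Membership.Propositional using () renaming (_∈_ to _∈ᴸ_; _∉_ to _∉ᴸ_)
open import Data.List.Membership.Propositional.Properties using (∈-map⁺; ∈-map⁻)
open import Data.List.Relation.Unary.All using ([]; _∷_)
open import Data.List.Relation.Unary.AllPairs using ([]; _∷_)
open import Data.List.Relation.Unary.Any using (here; there)
open import Data.List.Relation.Unary.Linked using ([-]; _∷_)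
open import Data.Maybe.Base using (just)
open import Data.Nat using (ℕ; zero; suc; _+_; _≤_; _<_; _%_; z≤n; s≤s)
open import Data.Nat.Properties using (<-cmp; ≤-trans)
open import Data.Product.Base using (∃; ∃₂; _×_; _,_; proj₁; proj₂)
open import Data.Sum.Base using (_⊎_; inj₁; inj₂; [_,_])
open import Data.Unit.Base using (tt)
open import Data.Vec.Base using (_∷_; here; there)
open import Function.Base using (_∘_; id)
open import Induction.WellFounded using (Acc; acc)
open import Relation.Binary.Definitions using (tri<; tri≈; tri>)
open import Relation.Binary.PropositionalEquality
  using (_≡_; _≢_; refl; sym; trans; cong; subst)
open import Relation.Nullary using (yes; no; ¬_; contradiction)
open import Relation.Nullary.Decidable using (¬?; _×-dec_; decidable-stable)

open Game using (Position; options; finite)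
open Graph using (Adj; adj?; adj-sym)

-- Nim-values in games where every move lowers a size by one.

mex-unique : ∀ {A k} → k ∉ᴸ A → (∀ j → j < k → j ∈ᴸ A) → mex A ≡ k
mex-unique {A} {k} k∉A below with <-cmp (mex A) k
... | tri< mex<k _ _ = contradiction (below _ mex<k) (mex-∉ A)
... | tri≈ _ mex≡k _ = mex≡k
... | tri> _ _ k<mex = contradiction (mex-least A k k<mex) k∉A

%2-suc : ∀ k → (k % 2 ≡ 0 × suc k % 2 ≡ 1) ⊎ (k % 2 ≡ 1 × suc k % 2 ≡ 0)
%2-suc zero          = inj₁ (refl , refl)
%2-suc (suc zero)    = inj₂ (refl , refl)
%2-suc (suc (suc k)) = %2-suc k

module _ (𝒢 : Game) (size : Position 𝒢 → ℕ)
  (option-size : ∀ {p q} → q ∈ᴸ options 𝒢 p → suc (size q) ≡ size p)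
  (odd⇒option : ∀ p → size p % 2 ≡ 1 → ∃ λ q → q ∈ᴸ options 𝒢 p)
  where

  -- Every option has the opposite parity, so by induction all options share one nim-value. For even
  -- size that value is 1 and the mex is 0, even if no option exists; for odd size it is 0, and
  -- `odd⇒option` ensures that it occurs.
  nimPos-parity : ∀ p → nimPos 𝒢 p ≡ size p % 2
  nimPos-parity p = go p (finite 𝒢 p)
    where
    go : ∀ p → Acc (λ q p → q ∈ᴸ options 𝒢 p) p → nimPos 𝒢 p ≡ size p % 2
    go p (acc rs) = trans (nimPos-unfold 𝒢 p) (mex-unique nim∉ below)
      where
      values = map (nimPos 𝒢) (options 𝒢 p)

      flip : ∀ {q} → q ∈ᴸ options 𝒢 p →
             (nimPos 𝒢 q ≡ 0 × size p % 2 ≡ 1) ⊎ (nimPos 𝒢 q ≡ 1 × size p % 2 ≡ 0)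
      -- The induction hypothesis and `option-size` express everything through `size q`.
      flip {q} q∈ rewrite go q (rs q∈) | sym (option-size q∈) = %2-suc (size q)

      nim∉ : size p % 2 ∉ᴸ values
      nim∉ nim∈ with q , q∈ , eq ← ∈-map⁻ (nimPos 𝒢) nim∈ with flip q∈
      ... | inj₁ (q≡0 , p≡1) with () ← trans (sym p≡1) (trans eq q≡0)
      ... | inj₂ (q≡1 , p≡0) with () ← trans (sym p≡0) (trans eq q≡1)

      below : ∀ j → j < size p % 2 → j ∈ᴸ values
      below j j<p with %2-suc (size p)
      ... | inj₁ (p≡0 , _) with () ← subst (j <_) p≡0 j<p
      ... | inj₂ (p≡1 , _) with subst (j <_) p≡1 j<p | odd⇒option p p≡1
      -- The pattern `s≤s z≤n` forces `j` to be 0, so the value of a single option suffices.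
      ... | s≤s z≤n | q , q∈ with flip q∈
      ... | inj₁ (q≡0 , _) = subst (_∈ᴸ values) q≡0 (∈-map⁺ (nimPos 𝒢) q∈)
      ... | inj₂ (_ , p≡0) with () ← trans (sym p≡1) p≡0

-- Counting the complement of a subset.

∁⊥≡⊤ : ∀ n → ∁ (⊥ {n}) ≡ ⊤
∁⊥≡⊤ n = ⊆-antisym (⊆-max _) λ _ → x∉p⇒x∈∁p ∉⊥

∣∁[p∪⁅x⁆]∣ : ∀ {n} (p : Subset n) {x} → x ∉ p → suc ∣ ∁ (p ∪ ⁅ x ⁆) ∣ ≡ ∣ ∁ p ∣
∣∁[p∪⁅x⁆]∣ (inside  ∷ p) {zero}  x∉ = contradiction here x∉
∣∁[p∪⁅x⁆]∣ (outside ∷ p) {zero}  x∉ = cong (λ q → suc ∣ ∁ q ∣) (∪-identityʳ p)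
∣∁[p∪⁅x⁆]∣ (inside  ∷ p) {suc x} x∉ = ∣∁[p∪⁅x⁆]∣ p (x∉ ∘ there)
∣∁[p∪⁅x⁆]∣ (outside ∷ p) {suc x} x∉ = cong suc (∣∁[p∪⁅x⁆]∣ p (x∉ ∘ there))

x∉p∪⁅y⁆ : ∀ {n} {p : Subset n} {x y} → x ∉ p → x ≢ y → x ∉ p ∪ ⁅ y ⁆
x∉p∪⁅y⁆ {p = p} {y = y} x∉p x≢y = [ x∉p , x≢y ∘ x∈⁅y⁆⇒x≡y y ] ∘ x∈p∪q⁻ p ⁅ y ⁆

∣p∣-odd⇒Nonempty : ∀ {n} {p : Subset n} → ∣ p ∣ % 2 ≡ 1 → Nonempty p
∣p∣-odd⇒Nonempty {n} {p} odd with nonempty? p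
... | yes ne = ne
... | no  em with () ← trans (sym odd) (cong (_% 2) (trans (cong ∣_∣ (Empty-unique em)) (∣⊥∣≡0 n)))

-- Removing `a` and `b` from the complement lowers its size by two, so it stays odd and hence
-- nonempty.
odd⇒third : ∀ {n} (P : Subset n) {a b} → a ∉ P → b ∉ P → a ≢ b → ∣ ∁ P ∣ % 2 ≡ 1 →
            ∃ λ c → c ∉ P × c ≢ a × c ≢ b
odd⇒third P {a} {b} a∉P b∉P a≢b odd = c , c∉P , c≢a , c≢b
  where
  P+a = P ∪ ⁅ a ⁆
  P+ab = P+a ∪ ⁅ b ⁆

  size : suc (suc ∣ ∁ P+ab ∣) ≡ ∣ ∁ P ∣
  size = trans (cong suc (∣∁[p∪⁅x⁆]∣ P+a (x∉p∪⁅y⁆ b∉P (a≢b ∘ sym)))) (∣∁[p∪⁅x⁆]∣ P a∉P)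

  third : Nonempty (∁ P+ab)
  -- `suc (suc k) % 2` computes to `k % 2`, so oddness transfers along `size`.
  third = ∣p∣-odd⇒Nonempty (trans (cong (_% 2) size) odd)

  c = proj₁ third
  c∉P+ab : c ∉ P+ab
  c∉P+ab = x∈∁p⇒x∉p (proj₂ third)

  c∉P : c ∉ P
  c∉P c∈P = c∉P+ab (x∈p∪q⁺ (inj₁ (x∈p∪q⁺ (inj₁ c∈P))))

  c≢a : c ≢ a
  c≢a c≡a = c∉P+ab (x∈p∪q⁺ (inj₁ (x∈p∪q⁺ (inj₂ (subst (_∈ ⁅ a ⁆) (sym c≡a) (x∈⁅x⁆ a))))))

  c≢b : c ≢ b
  c≢b c≡b = c∉P+ab (x∈p∪q⁺ (inj₂ (subst (_∈ ⁅ b ⁆) (sym c≡b) (x∈⁅x⁆ b))))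

-- Convex sets, cliques and non-adjacent pairs.

module _ {v : ℕ} (G : Graph v) where

  NonAdj : Fin v → Fin v → Set
  NonAdj u w = u ≢ w × ¬ Adj G u w

  -- The hull of the pair is all of V, phrased through arbitrary convex sets so that no hull has to
  -- be computed.
  Spanning : Fin v → Fin v → Set
  Spanning u w = ∀ {K} → Convex G K → u ∈ K → w ∈ K → ∀ x → x ∈ K

  ∈-endpoints : ∀ {K u w x} (xs : List (Fin v)) → length xs ≤ 2 →
                head xs ≡ just u → last xs ≡ just w → u ∈ K → w ∈ K → x ∈ᴸ xs → x ∈ K
  ∈-endpoints (_ ∷ [])     _ refl _    u∈K w∈K (here refl)         = u∈K
  ∈-endpoints (_ ∷ _ ∷ []) _ refl refl u∈K w∈K (here refl)         = u∈K
  ∈-endpoints (_ ∷ _ ∷ []) _ refl refl u∈K w∈K (there (here refl)) = w∈K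
  ∈-endpoints (_ ∷ _ ∷ _ ∷ _) (s≤s (s≤s ()))

  -- An edge is itself a path, so a shortest path between clique vertices has at most two vertices
  -- and no interior.
  clique⇒convex : ∀ {K} → (∀ {u w} → u ∈ K → w ∈ K → u ≢ w → Adj G u w) → Convex G K
  clique⇒convex clique u w u∈K w∈K xs ((hd , lst , _) , shortest) x =
    ∈-endpoints xs length≤2 hd lst u∈K w∈K
    where
    length≤2 : length xs ≤ 2
    length≤2 with u ≟ w
    -- For equal endpoints the two-vertex list would repeat a vertex, so the comparison is with the
    -- one-vertex path.
    ... | yes refl = ≤-trans (shortest (u ∷ []) (refl , refl , [-] , [] ∷ [])) (s≤s z≤n)
    ... | no  u≢w  = shortest (u ∷ w ∷ [])
      (refl , refl , clique u∈K w∈K u≢w ∷ [-] , (u≢w ∷ []) ∷ [] ∷ [])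

  nonAdj⇒path-length≥3 : ∀ {u w} → NonAdj u w → ∀ ys → IsPath G u w ys → 3 ≤ length ys
  nonAdj⇒path-length≥3 (u≢w , _) (_ ∷ []) (refl , refl , _) = contradiction refl u≢w
  nonAdj⇒path-length≥3 (_ , ¬uw) (_ ∷ _ ∷ []) (refl , refl , uw ∷ _ , _) =
    contradiction uw ¬uw
  nonAdj⇒path-length≥3 _ (_ ∷ _ ∷ _ ∷ _) _ = s≤s (s≤s (s≤s z≤n))

  -- The path `u`, `x`, `w` is shortest, because a path between non-adjacent vertices has at least
  -- three vertices.
  convex-commonNeighbour : ∀ {K u w x} → Convex G K → NonAdj u w → u ∈ K → w ∈ K →
                           Adj G u x → Adj G x w → x ∈ K
  convex-commonNeighbour {K} {u} {w} {x} convex nonAdj u∈K w∈K ux xw =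
    convex u w u∈K w∈K (u ∷ x ∷ w ∷ [])
      ((refl , refl , ux ∷ xw ∷ [-] ,
        (adj⇒≢ ux ∷ proj₁ nonAdj ∷ []) ∷ (adj⇒≢ xw ∷ []) ∷ [] ∷ []) ,
       nonAdj⇒path-length≥3 nonAdj)
      x (there (here refl))
    where
    adj⇒≢ : ∀ {y z} → Adj G y z → y ≢ z
    adj⇒≢ yz refl = Graph.adj-irr G yz

  -- DNT on a non-complete graph whose non-adjacent pairs all span.

  module _ (nonComplete : ∃₂ NonAdj) (spanning : ∀ {u w} → NonAdj u w → Spanning u w) where

    nonAdj⇒isPosition : ∀ {P u w} → NonAdj u w → u ∉ P → w ∉ P → IsPosition G P
    nonAdj⇒isPosition {P} nonAdj u∉P w∉P = ⊆-antisym (⊆-max _) λ {x} _ →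
      spanning nonAdj (hull-convex G (∁ P))
        (⊆-hull G (∁ P) (x∉p⇒x∈∁p u∉P)) (⊆-hull G (∁ P) (x∉p⇒x∈∁p w∉P)) x

    -- If the finite search fails, `∁ P` is a clique, hence convex and its own hull. Being a
    -- position then makes `∁ P` all of V, against `nonComplete`.
    isPosition⇒nonAdj : ∀ {P} → IsPosition G P → ∃₂ λ u w → NonAdj u w × u ∉ P × w ∉ P
    isPosition⇒nonAdj {P} pos
      with any? (λ u → any? λ w → (¬? (u ≟ w) ×-dec ¬? (adj? G u w)) ×-dec
                                 (¬? (u ∈? P) ×-dec ¬? (w ∈? P)))
    ... | yes found = found
    ... | no  none  = let a , b , a≢b , ¬ab = nonComplete in
      contradiction (clique (∈∁P a) (∈∁P b) a≢b) ¬ab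
      where
      clique : ∀ {u w} → u ∈ ∁ P → w ∈ ∁ P → u ≢ w → Adj G u w
      clique {u} {w} u∈ w∈ u≢w = decidable-stable (adj? G u w) λ ¬uw →
        none (u , w , (u≢w , ¬uw) , x∈∁p⇒x∉p u∈ , x∈∁p⇒x∉p w∈)

      ∈∁P : ∀ x → x ∈ ∁ P
      ∈∁P x = hull-least G (clique⇒convex clique) id (subst (x ∈_) (sym pos) ∈⊤)

    -- A non-adjacent pair outside `P` exists; taking a third vertex leaves that pair outside, and
    -- it certifies the new position.
    odd⇒option : ∀ p → pty (∁ (proj₁ p)) ≡ 1 → ∃ λ q → q ∈ᴸ dntOptions G p
    odd⇒option p@(P , pos) odd
      with a , b , nonAdj@(a≢b , _) , a∉P , b∉P ← isPosition⇒nonAdj pos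
      with c , c∉P , c≢a , c≢b ← odd⇒third P a∉P b∉P a≢b odd
      = q , ∈-dntOptions⁺ G q p (c , c∉P , refl)
      where
      q : DNTPosition G
      q = P ∪ ⁅ c ⁆ ,
          nonAdj⇒isPosition nonAdj (x∉p∪⁅y⁆ a∉P (c≢a ∘ sym)) (x∉p∪⁅y⁆ b∉P (c≢b ∘ sym))

    option-size : ∀ {p q} → q ∈ᴸ dntOptions G p →
                    suc ∣ ∁ (proj₁ q) ∣ ≡ ∣ ∁ (proj₁ p) ∣
    option-size {p} {q} q∈ with x , x∉P , refl ← ∈-dntOptions⁻ G q p q∈ =
      ∣∁[p∪⁅x⁆]∣ (proj₁ p) x∉P

    nim-DNT : nim (DNT G) ≡ pty (⊤ {v})
    nim-DNT = trans
      -- The size of a position is the number of vertices not yet taken.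
      (nimPos-parity (DNT G) (λ p → ∣ ∁ (proj₁ p) ∣)
        (λ {p} {q} → option-size {p} {q}) odd⇒option _)
      (cong pty (∁⊥≡⊤ v))

-- Joins of two non-complete graphs.

module _ {m n : ℕ} (G : Graph m) (H : Graph n) where

  -- A view: matching on it refines the vertex itself to `i ↑ˡ n` or `m ↑ʳ j`.
  data Side : Fin (m + n) → Set where
    left  : ∀ i → Side (i ↑ˡ n)
    right : ∀ j → Side (m ↑ʳ j)

  side : ∀ x → Side x
  side x with splitAt m x in eq
  ... | inj₁ i = subst Side (splitAt⁻¹-↑ˡ eq) (left i)
  ... | inj₂ j = subst Side (splitAt⁻¹-↑ʳ {m} eq) (right j)

  join-adjˡʳ : ∀ i j → Adj (Join G H) (i ↑ˡ n) (m ↑ʳ j)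
  join-adjˡʳ i j rewrite splitAt-↑ˡ m i n | splitAt-↑ʳ m n j = tt

  join-adjʳˡ : ∀ j i → Adj (Join G H) (m ↑ʳ j) (i ↑ˡ n)
  join-adjʳˡ j i = adj-sym (Join G H) {i ↑ˡ n} {m ↑ʳ j} (join-adjˡʳ i j)

  join-nonAdjˡ⁺ : ∀ {i i′} → NonAdj G i i′ → NonAdj (Join G H) (i ↑ˡ n) (i′ ↑ˡ n)
  join-nonAdjˡ⁺ {i} {i′} (i≢i′ , ¬ii′) = i≢i′ ∘ ↑ˡ-injective n i i′ , ¬adj
    where
    ¬adj : ¬ Adj (Join G H) (i ↑ˡ n) (i′ ↑ˡ n)
    ¬adj rewrite splitAt-↑ˡ m i n | splitAt-↑ˡ m i′ n = ¬ii′

  join-nonAdjʳ⁺ : ∀ {j j′} → NonAdj H j j′ → NonAdj (Join G H) (m ↑ʳ j) (m ↑ʳ j′)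
  join-nonAdjʳ⁺ {j} {j′} (j≢j′ , ¬jj′) = j≢j′ ∘ ↑ʳ-injective m j j′ , ¬adj
    where
    ¬adj : ¬ Adj (Join G H) (m ↑ʳ j) (m ↑ʳ j′)
    ¬adj rewrite splitAt-↑ʳ m n j | splitAt-↑ʳ m n j′ = ¬jj′

  module _ (nonCompleteˡ : ∃₂ (NonAdj G)) (nonCompleteʳ : ∃₂ (NonAdj H)) where

    -- Vertices on different sides are adjacent, so `u` and `w` share a side. Their common
    -- neighbours fill the other side, which in turn fills theirs.
    join-spanning : ∀ {u w} → NonAdj (Join G H) u w → Spanning (Join G H) u w
    join-spanning {u} {w} nonAdj {K} convex u∈K w∈K = spans (side u) (side w) nonAdj u∈K w∈K
      where
      left⇒right : ∀ {i i′} → NonAdj (Join G H) (i ↑ˡ n) (i′ ↑ˡ n) →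
                   i ↑ˡ n ∈ K → i′ ↑ˡ n ∈ K → ∀ j → m ↑ʳ j ∈ K
      left⇒right {i} {i′} nonAdj i∈K i′∈K j =
        convex-commonNeighbour (Join G H) convex nonAdj i∈K i′∈K
          (join-adjˡʳ i j) (join-adjʳˡ j i′)

      right⇒left : ∀ {j j′} → NonAdj (Join G H) (m ↑ʳ j) (m ↑ʳ j′) →
                   m ↑ʳ j ∈ K → m ↑ʳ j′ ∈ K → ∀ i → i ↑ˡ n ∈ K
      right⇒left {j} {j′} nonAdj j∈K j′∈K i =
        convex-commonNeighbour (Join G H) convex nonAdj j∈K j′∈K
          (join-adjʳˡ j i) (join-adjˡʳ i j′)

      allLeft : (∀ j → m ↑ʳ j ∈ K) → ∀ i → i ↑ˡ n ∈ K
      -- A non-adjacent pair of `H` has every left vertex as a common neighbour.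
      allLeft right∈K = let _ , _ , nonAdj = nonCompleteʳ in
        right⇒left (join-nonAdjʳ⁺ nonAdj) (right∈K _) (right∈K _)

      allRight : (∀ i → i ↑ˡ n ∈ K) → ∀ j → m ↑ʳ j ∈ K
      allRight left∈K = let _ , _ , nonAdj = nonCompleteˡ in
        left⇒right (join-nonAdjˡ⁺ nonAdj) (left∈K _) (left∈K _)

      everything : (∀ i → i ↑ˡ n ∈ K) → (∀ j → m ↑ʳ j ∈ K) → ∀ x → x ∈ K
      everything left∈K right∈K x with side x
      ... | left  i = left∈K i
      ... | right j = right∈K j

      spans : ∀ {u w} → Side u → Side w → NonAdj (Join G H) u w → u ∈ K → w ∈ K →
              ∀ x → x ∈ K
      spans (left i)  (left i′)  nonAdj u∈K w∈K = everything (allLeft right∈K) right∈K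
        where right∈K = left⇒right nonAdj u∈K w∈K
      spans (right j) (right j′) nonAdj u∈K w∈K = everything left∈K (allRight left∈K)
        where left∈K = right⇒left nonAdj u∈K w∈K
      spans (left i)  (right j) (_ , ¬adj) = contradiction (join-adjˡʳ i j) ¬adj
      spans (right j) (left i)  (_ , ¬adj) = contradiction (join-adjʳˡ j i) ¬adj

    nim-DNT-join : nim (DNT (Join G H)) ≡ pty (⊤ {m + n})
    nim-DNT-join = let _ , _ , nonAdj = nonCompleteˡ in
      nim-DNT (Join G H) (_ , _ , join-nonAdjˡ⁺ nonAdj) join-spanning

-- Non-adjacent pairs in the two factors of the wheel.

edgeless-nonComplete : ∀ {m} → 2 ≤ m → ∃₂ (NonAdj (Edgeless m))
edgeless-nonComplete (s≤s (s≤s _)) = zero , suc zero , (λ ()) , λ ()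

cycle-nonComplete : ∀ {n} → 4 ≤ n → ∃₂ (NonAdj (Cycle n))
-- Vertices 0 and 2 are not consecutive, and the wrap-around edge joins them only when `n` is 3.
cycle-nonComplete {n} (s≤s (s≤s (s≤s (s≤s _)))) = zero , suc (suc zero) , (λ ()) , ¬adj
  where
  ¬adj : ¬ Adj (Cycle n) zero (suc (suc zero))
  ¬adj (_ , inj₁ (step ()))
  ¬adj (_ , inj₁ (wrap () _))
  ¬adj (_ , inj₂ (step ()))
  ¬adj (_ , inj₂ (wrap () _))

proposition5p32 : (m n : ℕ) → 2 ≤ m → 4 ≤ n →
    nim (DNT (Wheel m n)) ≡ pty (⊤ {m + n})
proposition5p32 m n 2≤m 4≤n =
  nim-DNT-join (Edgeless m) (Cycle n) (edgeless-nonComplete 2≤m) (cycle-nonComplete 4≤n)
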